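{- Let $(X_n)$ be a sequence of finite sets and let $(\mathcal{F}_n)$ be a sequence of nontrivial upper sets $\mathcal{F}_n \subseteq 2^{X_n}$. Let $K>0$ be a constant such that $p_c(\mathcal{F}_n)\leq K q(\mathcal{F}_n)\log \ell(\mathcal{F}_n)$ for all $n$. Suppose $\ell(\mathcal{F}_n)\to\infty$ and that the Kahn-Kalai bounds provide nontrivial information for $(\mathcal{F}_n)$. Then for every fixed integer $t\geq 0$ there exists $N$ such that for all $n\geq N$, $\sigma_{|(\mathcal{F}_n)_0|-t}\big(S : S\in(\mathcal{F}_n)_0\big)=\emptyset$; that is, the intersection of all but any $t$ of the minimal elements of $\mathcal{F}_n$ is eventually empty.
   Context: For a finite set $X$, an upper set is a subset $\mathcal{F}\subseteq 2^X$ such that $A\in\mathcal{F}$ and $A\subseteq B\subseteq X$ imply $B\in\mathcal{F}$; it is nontrivial if $\mathcal{F}\neq\emptyset$ and $\mathcal{F}\neq 2^X$. For $p\in[0,1]$ let $\mu_p(\mathcal{F})=\sum_{S\in\mathcal{F}}p^{|S|}(1-p)^{|X|-|S|}$; for nontrivial $\mathcal{F}$, the critical probability $p_c(\mathcal{F})$ is the unique $p\in[0,1]$ with $\mu_p(\mathcal{F})=\frac12$. For $S\subseteq X$ let $\langle S\rangle=\{T\subseteq X: S\subseteq T\}$. A set $\mathcal{G}\subseteq 2^X$ is a cover of $\mathcal{F}$ if $\mathcal{F}\subseteq\bigcup_{S\in\mathcal{G}}\langle S\rangle$. $\mathcal{F}$ is $p$-small if it has a cover $\mathcal{G}$ with $\sum_{S\in\mathcal{G}}p^{|S|}\leq\frac12$.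 The expectation threshold $q(\mathcal{F})$ is the largest $p\in[0,1]$ for which $\mathcal{F}$ is $p$-small. $\mathcal{F}_0$ denotes the set of (inclusion-)minimal elements of $\mathcal{F}$, $\ell_0(\mathcal{F})=\max\{|S|:S\in\mathcal{F}_0\}$ and $\ell(\mathcal{F})=\max\{\ell_0(\mathcal{F}),2\}$. $\log$ is the logarithm to base 2. The Kahn-Kalai bounds provide nontrivial information for $(\mathcal{F}_n)$ if there exists $N$ such that $Kq(\mathcal{F}_n)\log\ell(\mathcal{F}_n)<1$ for all $n\geq N$. For subsets $S_1,\dots,S_m$ of $X$ and an integer $k$, $\sigma_k(S_1,\dots,S_m)=\bigcup_{I\subseteq\{1,\dots,m\},\ |I|=k}\big(\bigcap_{i\in I}S_i\big)$ (the lattice-theoretic elementary symmetric polynomial), with the empty intersection equal to $X$ and the empty union equal to $\emptyset$. -}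

module Defs where

open import Data.Bool.Base using (Bool; T)
open import Data.Fin.Base using (Fin)
open import Data.Fin.Subset
  using (Subset; inside; outside; _⊆_; _⊂_; ∣_∣; ⋃; ⋂)
open import Data.Fin.Subset.Properties using (_∈?_; _⊂?_; anySubset?)
open import Data.Integer.Base as ℤ using (ℤ; +_)
import Data.Integer.Properties as ℤ
import Data.Integer.Solver as ℤ-Solver
open import Data.List.Base using (List; []; _∷_; _++_; map; foldr; filter; allFin)
open import Data.List.Extrema.Nat using (max)
open import Data.Nat.Base as ℕ using (ℕ; zero; suc; _⊔_; _∸_; ⌊_/2⌋; ⌈_/2⌉)
open import Data.Nat.Induction using (<-rec)
open import Data.Nat.Logarithm
  using (⌊log₂_⌋; ⌊log₂⌋-mono-≤; ⌊log₂⌊n/2⌋⌋≡⌊log₂n⌋∸1; ⌊log₂[2^n]⌋≡n)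
import Data.Nat.Properties as ℕ
open import Data.Product.Base using (∃-syntax; _×_; _,_)
open import Data.Rational.Base as ℚ using (ℚ; 0ℚ; 1ℚ; ½)
import Data.Rational.Properties as ℚ
import Data.Rational.Solver as ℚ-Solver
import Data.Rational.Unnormalised.Base as ℚᵘ
import Data.Rational.Unnormalised.Properties as ℚᵘ
open import Data.Sum.Base using (inj₁; inj₂)
open import Data.Vec.Base using ([]; _∷_)
open import Relation.Binary.PropositionalEquality
  using (_≡_; refl; sym; trans; cong; subst; subst₂)
open import Relation.Nullary.Decidable using (Dec; _×-dec_; ¬?; T?)
open import Relation.Nullary.Negation using (¬_)

-- Real numbers are Cauchy sequences of rationals, considered up to _≃_.

IsCauchy : (ℕ → ℚ) → Set
IsCauchy x = ∀ ε → 0ℚ ℚ.< ε →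
  ∃[ N ] (∀ m n → N ℕ.≤ m → N ℕ.≤ n → ℚ.∣ x m ℚ.- x n ∣ ℚ.< ε)

record ℝ : Set where
  constructor mkℝ
  field
    seq    : ℕ → ℚ
    cauchy : IsCauchy seq

open ℝ public

half : ∀ ε → 0ℚ ℚ.< ε → 0ℚ ℚ.< ½ ℚ.* ε
half ε 0<ε = subst (ℚ._< ½ ℚ.* ε) (ℚ.*-zeroʳ ½) (ℚ.*-monoʳ-<-pos ½ 0<ε)

half+half : ∀ ε → ½ ℚ.* ε ℚ.+ ½ ℚ.* ε ≡ ε
half+half ε = trans (sym (ℚ.*-distribʳ-+ ε ½ ½)) (ℚ.*-identityˡ ε)

const-cauchy : ∀ a → IsCauchy (λ _ → a)
const-cauchy a ε 0<ε = 0 , λ _ _ _ _ →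
  subst (ℚ._< ε) (sym (cong ℚ.∣_∣ (ℚ.+-inverseʳ a))) 0<ε

+-cauchy : ∀ {x y} → IsCauchy x → IsCauchy y → IsCauchy (λ n → x n ℚ.+ y n)
+-cauchy {x} {y} cx cy ε 0<ε =
  let (M , hx) = cx (½ ℚ.* ε) (half ε 0<ε)
      (N , hy) = cy (½ ℚ.* ε) (half ε 0<ε)
  in M ⊔ N , λ m n m≥ n≥ → begin-strict
    ℚ.∣ (x m ℚ.+ y m) ℚ.- (x n ℚ.+ y n) ∣
      ≡⟨ cong ℚ.∣_∣ (rearrange (x m) (y m) (x n) (y n)) ⟩
    ℚ.∣ (x m ℚ.- x n) ℚ.+ (y m ℚ.- y n) ∣
      ≤⟨ ℚ.∣p+q∣≤∣p∣+∣q∣ (x m ℚ.- x n) (y m ℚ.- y n) ⟩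
    ℚ.∣ x m ℚ.- x n ∣ ℚ.+ ℚ.∣ y m ℚ.- y n ∣
      <⟨ ℚ.+-mono-< (hx m n (ℕ.m⊔n≤o⇒m≤o M N m≥) (ℕ.m⊔n≤o⇒m≤o M N n≥))
                    (hy m n (ℕ.m⊔n≤o⇒n≤o M N m≥) (ℕ.m⊔n≤o⇒n≤o M N n≥)) ⟩
    ½ ℚ.* ε ℚ.+ ½ ℚ.* ε
      ≡⟨ half+half ε ⟩
    ε ∎
  where
  open ℚ.≤-Reasoning
  open ℚ-Solver.+-*-Solver
  rearrange : ∀ a b c d → (a ℚ.+ b) ℚ.- (c ℚ.+ d) ≡ (a ℚ.- c) ℚ.+ (b ℚ.- d)
  rearrange = solve 4 (λ a b c d → (a :+ b) :- (c :+ d) := (a :- c) :+ (b :- d)) refl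

neg-cauchy : ∀ {x} → IsCauchy x → IsCauchy (λ n → ℚ.- x n)
neg-cauchy {x} cx ε 0<ε =
  let (N , hx) = cx ε 0<ε
  in N , λ m n m≥ n≥ →
    subst (ℚ._< ε)
      (trans (sym (ℚ.∣-p∣≡∣p∣ (x m ℚ.- x n))) (cong ℚ.∣_∣ (ℚ.neg-distrib-+ (x m) (ℚ.- x n))))
      (hx m n m≥ n≥)

Bounded : (ℕ → ℚ) → Set
Bounded x = ∃[ B ] (0ℚ ℚ.< B × ∃[ N ] (∀ n → N ℕ.≤ n → ℚ.∣ x n ∣ ℚ.< B))

bounded : ∀ {x} → IsCauchy x → Bounded x
bounded {x} cx =
  let (N , hx) = cx 1ℚ (ℚ.positive⁻¹ 1ℚ)
      bound : ∀ n → N ℕ.≤ n → ℚ.∣ x n ∣ ℚ.< 1ℚ ℚ.+ ℚ.∣ x N ∣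
      bound n n≥ = begin-strict
        ℚ.∣ x n ∣                        ≡⟨ cong ℚ.∣_∣ (split (x n) (x N)) ⟩
        ℚ.∣ (x n ℚ.- x N) ℚ.+ x N ∣      ≤⟨ ℚ.∣p+q∣≤∣p∣+∣q∣ (x n ℚ.- x N) (x N) ⟩
        ℚ.∣ x n ℚ.- x N ∣ ℚ.+ ℚ.∣ x N ∣  <⟨ ℚ.+-monoˡ-< ℚ.∣ x N ∣ (hx n N n≥ ℕ.≤-refl) ⟩
        1ℚ ℚ.+ ℚ.∣ x N ∣                 ∎
  in 1ℚ ℚ.+ ℚ.∣ x N ∣ , ℚ.≤-<-trans (ℚ.0≤∣p∣ (x N)) (bound N ℕ.≤-refl) , N , bound
  where
  open ℚ.≤-Reasoning
  open ℚ-Solver.+-*-Solver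
  split : ∀ a b → a ≡ (a ℚ.- b) ℚ.+ b
  split = solve 2 (λ a b → a := (a :- b) :+ b) refl

*-bound : ∀ {B d} a e → 0ℚ ℚ.< B → ℚ.∣ a ∣ ℚ.< B → ℚ.∣ e ∣ ℚ.< d → ℚ.∣ a ℚ.* e ∣ ℚ.< B ℚ.* d
*-bound {B} {d} a e 0<B a<B e<d = begin-strict
  ℚ.∣ a ℚ.* e ∣        ≡⟨ ℚ.∣p*q∣≡∣p∣*∣q∣ a e ⟩
  ℚ.∣ a ∣ ℚ.* ℚ.∣ e ∣  ≤⟨ ℚ.*-monoʳ-≤-nonNeg ℚ.∣ e ∣ {{ℚ.∣-∣-nonNeg e}} (ℚ.<⇒≤ a<B) ⟩
  B ℚ.* ℚ.∣ e ∣        <⟨ ℚ.*-monoʳ-<-pos B {{ℚ.positive 0<B}} e<d ⟩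
  B ℚ.* d              ∎
  where open ℚ.≤-Reasoning

divide : ∀ B ε → 0ℚ ℚ.< B → 0ℚ ℚ.< ε → ∃[ δ ] (0ℚ ℚ.< δ × B ℚ.* δ ≡ ε)
divide B ε 0<B 0<ε = B⁻¹ ℚ.* ε , positive , cancel
  where
  B>0 : ℚ.Positive B
  B>0 = ℚ.positive 0<B
  B≢0 : ℚ.NonZero B
  B≢0 = ℚ.pos⇒nonZero B {{B>0}}
  B⁻¹ : ℚ
  B⁻¹ = (ℚ.1/ B) {{B≢0}}
  positive : 0ℚ ℚ.< B⁻¹ ℚ.* ε
  positive = subst (ℚ._< B⁻¹ ℚ.* ε) (ℚ.*-zeroʳ B⁻¹)
                   (ℚ.*-monoʳ-<-pos B⁻¹ {{ℚ.1/pos⇒pos B {{B>0}}}} 0<ε)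
  cancel : B ℚ.* (B⁻¹ ℚ.* ε) ≡ ε
  cancel = trans (sym (ℚ.*-assoc B B⁻¹ ε))
          (trans (cong (ℚ._* ε) (ℚ.*-inverseʳ B {{B≢0}})) (ℚ.*-identityˡ ε))

*-rearrange : ∀ a b c d → a ℚ.* b ℚ.- c ℚ.* d ≡ a ℚ.* (b ℚ.- d) ℚ.+ d ℚ.* (a ℚ.- c)
*-rearrange = solve 4 (λ a b c d → a :* b :- c :* d := a :* (b :- d) :+ d :* (a :- c)) refl
  where open ℚ-Solver.+-*-Solver

*-close : ∀ {B C δ} a b c d → 0ℚ ℚ.< B → 0ℚ ℚ.< C →
          ℚ.∣ a ∣ ℚ.< B → ℚ.∣ d ∣ ℚ.< C → ℚ.∣ a ℚ.- c ∣ ℚ.< δ → ℚ.∣ b ℚ.- d ∣ ℚ.< δ →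
          ℚ.∣ a ℚ.* b ℚ.- c ℚ.* d ∣ ℚ.< (B ℚ.+ C) ℚ.* δ
*-close {B} {C} {δ} a b c d 0<B 0<C a<B d<C ac bd = begin-strict
  ℚ.∣ a ℚ.* b ℚ.- c ℚ.* d ∣
    ≡⟨ cong ℚ.∣_∣ (*-rearrange a b c d) ⟩
  ℚ.∣ a ℚ.* (b ℚ.- d) ℚ.+ d ℚ.* (a ℚ.- c) ∣
    ≤⟨ ℚ.∣p+q∣≤∣p∣+∣q∣ (a ℚ.* (b ℚ.- d)) (d ℚ.* (a ℚ.- c)) ⟩
  ℚ.∣ a ℚ.* (b ℚ.- d) ∣ ℚ.+ ℚ.∣ d ℚ.* (a ℚ.- c) ∣
    <⟨ ℚ.+-mono-< (*-bound a (b ℚ.- d) 0<B a<B bd) (*-bound d (a ℚ.- c) 0<C d<C ac) ⟩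
  B ℚ.* δ ℚ.+ C ℚ.* δ
    ≡⟨ sym (ℚ.*-distribʳ-+ δ B C) ⟩
  (B ℚ.+ C) ℚ.* δ ∎
  where open ℚ.≤-Reasoning

*-cauchy : ∀ {x y} → IsCauchy x → IsCauchy y → IsCauchy (λ n → x n ℚ.* y n)
*-cauchy {x} {y} cx cy ε 0<ε =
  let (B , 0<B , M₀ , hB)  = bounded cx
      (C , 0<C , N₀ , hC)  = bounded cy
      (δ , 0<δ , [B+C]δ≡ε) = divide (B ℚ.+ C) ε (ℚ.+-mono-< 0<B 0<C) 0<ε
      (M , hx) = cx δ 0<δ
      (N , hy) = cy δ 0<δ
  in (M₀ ⊔ N₀) ⊔ (M ⊔ N) , λ m n m≥ n≥ →
    let m≥₀ = ℕ.m⊔n≤o⇒m≤o (M₀ ⊔ N₀) (M ⊔ N) m≥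
        n≥₀ = ℕ.m⊔n≤o⇒m≤o (M₀ ⊔ N₀) (M ⊔ N) n≥
        m≥₁ = ℕ.m⊔n≤o⇒n≤o (M₀ ⊔ N₀) (M ⊔ N) m≥
        n≥₁ = ℕ.m⊔n≤o⇒n≤o (M₀ ⊔ N₀) (M ⊔ N) n≥
    in subst (ℚ.∣ x m ℚ.* y m ℚ.- x n ℚ.* y n ∣ ℚ.<_) [B+C]δ≡ε
         (*-close (x m) (y m) (x n) (y n) 0<B 0<C
           (hB m (ℕ.m⊔n≤o⇒m≤o M₀ N₀ m≥₀)) (hC n (ℕ.m⊔n≤o⇒n≤o M₀ N₀ n≥₀))
           (hx m n (ℕ.m⊔n≤o⇒m≤o M N m≥₁) (ℕ.m⊔n≤o⇒m≤o M N n≥₁))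
           (hy m n (ℕ.m⊔n≤o⇒n≤o M N m≥₁) (ℕ.m⊔n≤o⇒n≤o M N n≥₁)))

fromℚ : ℚ → ℝ
fromℚ a = mkℝ (λ _ → a) (const-cauchy a)

0ℝ 1ℝ ½ℝ : ℝ
0ℝ = fromℚ 0ℚ
1ℝ = fromℚ 1ℚ
½ℝ = fromℚ ½

infixl 6 _+_ _-_
infixl 7 _*_
infixr 8 _^_
infix  4 _<_ _≤_ _≃_

_+_ _*_ _-_ : ℝ → ℝ → ℝ
x + y = mkℝ (λ n → seq x n ℚ.+ seq y n) (+-cauchy {seq x} {seq y} (cauchy x) (cauchy y))
x * y = mkℝ (λ n → seq x n ℚ.* seq y n) (*-cauchy {seq x} {seq y} (cauchy x) (cauchy y))
x - y = mkℝ (λ n → seq x n ℚ.- seq y n)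
            (+-cauchy {seq x} {λ n → ℚ.- seq y n} (cauchy x) (neg-cauchy {seq y} (cauchy y)))

_^_ : ℝ → ℕ → ℝ
x ^ zero  = 1ℝ
x ^ suc k = x * x ^ k

-- x ≤ y is the negation of y < x; it allows seq x to exceed seq y by a null
-- sequence, so it is not the pointwise order.
_<_ _≤_ _≃_ : ℝ → ℝ → Set
x < y = ∃[ ε ] (0ℚ ℚ.< ε × ∃[ N ] (∀ n → N ℕ.≤ n → seq x n ℚ.+ ε ℚ.< seq y n))
x ≤ y = ¬ (y < x)
x ≃ y = ∀ ε → 0ℚ ℚ.< ε → ∃[ N ] (∀ n → N ℕ.≤ n → ℚ.∣ seq x n ℚ.- seq y n ∣ ℚ.< ε)

2^⌊log₂n⌋≤n : ∀ n .{{_ : ℕ.NonZero n}} → 2 ℕ.^ ⌊log₂ n ⌋ ℕ.≤ n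
2^⌊log₂n⌋≤n n = <-rec (λ n → .{{_ : ℕ.NonZero n}} → 2 ℕ.^ ⌊log₂ n ⌋ ℕ.≤ n) step n
  where
  step : ∀ n → (∀ {m} → m ℕ.< n → .{{_ : ℕ.NonZero m}} → 2 ℕ.^ ⌊log₂ m ⌋ ℕ.≤ m) →
         .{{_ : ℕ.NonZero n}} → 2 ℕ.^ ⌊log₂ n ⌋ ℕ.≤ n
  step 1 _ = ℕ.≤-refl
  step n@(suc (suc k)) rec = begin
    2 ℕ.^ ⌊log₂ n ⌋            ≤⟨ ℕ.^-monoʳ-≤ 2 (ℕ.m≤n+m∸n ⌊log₂ n ⌋ 1) ⟩
    2 ℕ.* 2 ℕ.^ (⌊log₂ n ⌋ ∸ 1)
      ≡⟨ cong (λ l → 2 ℕ.* 2 ℕ.^ l) (sym (⌊log₂⌊n/2⌋⌋≡⌊log₂n⌋∸1 n)) ⟩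
    2 ℕ.* 2 ℕ.^ ⌊log₂ ⌊ n /2⌋ ⌋ ≤⟨ ℕ.*-monoʳ-≤ 2 (rec (ℕ.⌊n/2⌋<n (suc k))) ⟩
    2 ℕ.* ⌊ n /2⌋              ≡⟨ cong (⌊ n /2⌋ ℕ.+_) (ℕ.+-identityʳ ⌊ n /2⌋) ⟩
    ⌊ n /2⌋ ℕ.+ ⌊ n /2⌋        ≤⟨ ℕ.+-monoʳ-≤ ⌊ n /2⌋ (ℕ.⌊n/2⌋≤⌈n/2⌉ n) ⟩
    ⌊ n /2⌋ ℕ.+ ⌈ n /2⌉        ≡⟨ ℕ.⌊n/2⌋+⌈n/2⌉≡n n ⟩
    n                          ∎
    where open ℕ.≤-Reasoning

n<2^[1+⌊log₂n⌋] : ∀ n → n ℕ.< 2 ℕ.^ suc ⌊log₂ n ⌋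
n<2^[1+⌊log₂n⌋] n = ℕ.≰⇒> λ 2^≤n → ℕ.<-irrefl refl
  (subst (ℕ._≤ ⌊log₂ n ⌋) (⌊log₂[2^n]⌋≡n (suc ⌊log₂ n ⌋)) (⌊log₂⌋-mono-≤ 2^≤n))

log-cross : ∀ m a b .{{_ : ℕ.NonZero m}} →
            ⌊log₂ m ℕ.^ a ⌋ ℕ.* b ℕ.≤ suc ⌊log₂ m ℕ.^ b ⌋ ℕ.* a
log-cross m a b = ℕ.≮⇒≥ λ lt → ℕ.<⇒≱ (ℕ.^-monoʳ-< 2 ℕ.≤-refl lt) (begin
  2 ℕ.^ (A ℕ.* b)      ≡⟨ sym (ℕ.^-*-assoc 2 A b) ⟩
  (2 ℕ.^ A) ℕ.^ b      ≤⟨ ℕ.^-monoˡ-≤ b (2^⌊log₂n⌋≤n (m ℕ.^ a) {{ℕ.m^n≢0 m a}}) ⟩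
  (m ℕ.^ a) ℕ.^ b      ≡⟨ ℕ.^-*-assoc m a b ⟩
  m ℕ.^ (a ℕ.* b)      ≡⟨ cong (m ℕ.^_) (ℕ.*-comm a b) ⟩
  m ℕ.^ (b ℕ.* a)      ≡⟨ sym (ℕ.^-*-assoc m b a) ⟩
  (m ℕ.^ b) ℕ.^ a      ≤⟨ ℕ.^-monoˡ-≤ a (ℕ.<⇒≤ (n<2^[1+⌊log₂n⌋] (m ℕ.^ b))) ⟩
  (2 ℕ.^ suc B) ℕ.^ a  ≡⟨ ℕ.^-*-assoc 2 (suc B) a ⟩
  2 ℕ.^ (suc B ℕ.* a)  ∎)
  where
  open ℕ.≤-Reasoning
  A = ⌊log₂ m ℕ.^ a ⌋
  B = ⌊log₂ m ℕ.^ b ⌋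

/-mono : ∀ p q c d → p ℕ.* suc d ℕ.≤ q ℕ.* suc c → + p ℚ./ suc c ℚ.≤ + q ℚ./ suc d
/-mono p q c d le = ℚ.toℚᵘ-cancel-≤ (begin
  ℚ.toℚᵘ (+ p ℚ./ suc c)  ≃⟨ ℚ.toℚᵘ-fromℚᵘ (ℚᵘ.mkℚᵘ (+ p) c) ⟩
  ℚᵘ.mkℚᵘ (+ p) c         ≤⟨ ℚᵘ.*≤* (subst₂ ℤ._≤_ (ℤ.pos-* p (suc d)) (ℤ.pos-* q (suc c)) (ℤ.+≤+ le)) ⟩
  ℚᵘ.mkℚᵘ (+ q) d         ≃⟨ ℚᵘ.≃-sym (ℚ.toℚᵘ-fromℚᵘ (ℚᵘ.mkℚᵘ (+ q) d)) ⟩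
  ℚ.toℚᵘ (+ q ℚ./ suc d)  ∎)
  where open ℚᵘ.≤-Reasoning

/-suc : ∀ q d → + suc q ℚ./ suc d ≡ + 1 ℚ./ suc d ℚ.+ + q ℚ./ suc d
/-suc q d = ℚ.toℚᵘ-injective (begin
  ℚ.toℚᵘ (+ suc q ℚ./ suc d)                ≈⟨ ℚ.toℚᵘ-fromℚᵘ (ℚᵘ.mkℚᵘ (+ suc q) d) ⟩
  ℚᵘ.mkℚᵘ (+ suc q) d                       ≈⟨ ℚᵘ.*≡* (cross (+ q) (+ suc d)) ⟩
  ℚᵘ.mkℚᵘ (+ 1) d ℚᵘ.+ ℚᵘ.mkℚᵘ (+ q) d
    ≈⟨ ℚᵘ.≃-sym (ℚᵘ.+-cong (ℚ.toℚᵘ-fromℚᵘ (ℚᵘ.mkℚᵘ (+ 1) d)) (ℚ.toℚᵘ-fromℚᵘ (ℚᵘ.mkℚᵘ (+ q) d))) ⟩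
  ℚ.toℚᵘ (+ 1 ℚ./ suc d) ℚᵘ.+ ℚ.toℚᵘ (+ q ℚ./ suc d)
    ≈⟨ ℚᵘ.≃-sym (ℚ.toℚᵘ-homo-+ (+ 1 ℚ./ suc d) (+ q ℚ./ suc d)) ⟩
  ℚ.toℚᵘ (+ 1 ℚ./ suc d ℚ.+ + q ℚ./ suc d)  ∎)
  where
  open ℚᵘ.≃-Reasoning
  cross : ∀ i j → (+ 1 ℤ.+ i) ℤ.* (j ℤ.* j) ≡ (+ 1 ℤ.* j ℤ.+ i ℤ.* j) ℤ.* j
  cross = solve 2 (λ i j → (con (+ 1) :+ i) :* (j :* j) := (con (+ 1) :* j :+ i :* j) :* j) refl
    where open ℤ-Solver.+-*-Solver

archimedean : ∀ ε → 0ℚ ℚ.< ε → ∃[ N ] (+ 1 ℚ./ suc N ℚ.< ε)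
archimedean (ℚ.mkℚ (+ 0) d c) (ℚ.*<* (ℤ.+<+ ()))
archimedean (ℚ.mkℚ ℤ.-[1+ n ] d c) (ℚ.*<* ())
archimedean ε@(ℚ.mkℚ ℤ.+[1+ e ] d c) _ = suc d , ℚ.toℚᵘ-cancel-< (begin-strict
  ℚ.toℚᵘ (+ 1 ℚ./ suc (suc d))  ≃⟨ ℚ.toℚᵘ-fromℚᵘ (ℚᵘ.mkℚᵘ (+ 1) (suc d)) ⟩
  ℚᵘ.mkℚᵘ (+ 1) (suc d)         <⟨ ℚᵘ.*<* (subst₂ ℤ._<_ (ℤ.pos-* 1 (suc d)) (ℤ.pos-* (suc e) (suc (suc d)))
                                     (ℤ.+<+ (ℕ.<-≤-trans (ℕ.≤-reflexive (cong suc (ℕ.*-identityˡ (suc d)))) (ℕ.m≤n*m (suc (suc d)) (suc e))))) ⟩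
  ℚᵘ.mkℚᵘ ℤ.+[1+ e ] d          ∎)
  where open ℚᵘ.≤-Reasoning

log-approx : ℕ → ℕ → ℚ
log-approx m n = + ⌊log₂ m ℕ.^ suc n ⌋ ℚ./ suc n

log-approx-close : ∀ m N k n .{{_ : ℕ.NonZero m}} → N ℕ.≤ n →
                   log-approx m k ℚ.- log-approx m n ℚ.≤ + 1 ℚ./ suc N
log-approx-close m N k n N≤n = begin
  x ℚ.- y                              ≤⟨ ℚ.+-monoˡ-≤ (ℚ.- y) (/-mono ⌊log₂ m ℕ.^ suc k ⌋ (suc B) k n (log-cross m (suc k) (suc n))) ⟩
  + suc B ℚ./ suc n ℚ.- y              ≡⟨ cong (ℚ._- y) (/-suc B n) ⟩
  (+ 1 ℚ./ suc n ℚ.+ y) ℚ.- y          ≡⟨ ℚ.+-assoc (+ 1 ℚ./ suc n) y (ℚ.- y) ⟩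
  + 1 ℚ./ suc n ℚ.+ (y ℚ.- y)          ≡⟨ cong (+ 1 ℚ./ suc n ℚ.+_) (ℚ.+-inverseʳ y) ⟩
  + 1 ℚ./ suc n ℚ.+ 0ℚ                 ≡⟨ ℚ.+-identityʳ (+ 1 ℚ./ suc n) ⟩
  + 1 ℚ./ suc n                        ≤⟨ /-mono 1 1 n N (ℕ.+-monoˡ-≤ 0 (ℕ.s≤s N≤n)) ⟩
  + 1 ℚ./ suc N                        ∎
  where
  open ℚ.≤-Reasoning
  x = log-approx m k
  y = log-approx m n
  B = ⌊log₂ m ℕ.^ suc n ⌋

∣-∣≤ : ∀ x y {r} → x ℚ.- y ℚ.≤ r → y ℚ.- x ℚ.≤ r → ℚ.∣ x ℚ.- y ∣ ℚ.≤ r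
∣-∣≤ x y xy yx with ℚ.∣p∣≡p∨∣p∣≡-p (x ℚ.- y)
... | inj₁ eq = subst (ℚ._≤ _) (sym eq) xy
... | inj₂ eq = subst (ℚ._≤ _) (sym (trans eq (neg-diff x y))) yx
  where
  open ℚ-Solver.+-*-Solver
  neg-diff : ∀ a b → ℚ.- (a ℚ.- b) ≡ b ℚ.- a
  neg-diff = solve 2 (λ a b → :- (a :- b) := b :- a) refl

log-cauchy : ∀ m .{{_ : ℕ.NonZero m}} → IsCauchy (log-approx m)
log-cauchy m ε 0<ε =
  let (N , 1/N<ε) = archimedean ε 0<ε
  in N , λ k n k≥ n≥ → ℚ.≤-<-trans
       (∣-∣≤ (log-approx m k) (log-approx m n)
             (log-approx-close m N k n n≥) (log-approx-close m N n k k≥))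
       1/N<ε

-- With k = n + 1 and a = ⌊log₂ m^k⌋ we have 2^a ≤ m^k < 2^(a+1), that is,
-- a/k ≤ log₂ m < a/k + 1/k.
log₂ : (m : ℕ) .{{_ : ℕ.NonZero m}} → ℝ
log₂ m = mkℝ (λ n → + ⌊log₂ m ℕ.^ suc n ⌋ ℚ./ suc n) (log-cauchy m)

-- The finite set X is Fin n, and a subset of 2^X is given by its
-- characteristic function.
Family : ℕ → Set
Family n = Subset n → Bool

private
  variable
    n : ℕ

infix 4 _∈ᶠ_ _∈ᶠ?_

_∈ᶠ_ : Subset n → Family n → Set
S ∈ᶠ F = T (F S)

_∈ᶠ?_ : (S : Subset n) (F : Family n) → Dec (S ∈ᶠ F)
S ∈ᶠ? F = T? (F S)

-- All subsets of Fin n, each listed once.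
subsets : ∀ n → List (Subset n)
subsets zero    = [] ∷ []
subsets (suc n) = map (outside ∷_) (subsets n) ++ map (inside ∷_) (subsets n)

elements : Family n → List (Subset n)
elements {n} F = filter (_∈ᶠ? F) (subsets n)

∑[_] : Family n → (Subset n → ℝ) → ℝ
∑[ F ] f = foldr (λ S s → f S + s) 0ℝ (elements F)

IsUpperSet : Family n → Set
IsUpperSet F = ∀ {A B} → A ∈ᶠ F → A ⊆ B → B ∈ᶠ F

IsNontrivial : Family n → Set
IsNontrivial F = ¬ (∀ S → ¬ (S ∈ᶠ F)) × ¬ (∀ S → S ∈ᶠ F)

μ : Family n → ℝ → ℝ
μ {n} F p = ∑[ F ] λ S → p ^ ∣ S ∣ * (1ℝ - p) ^ (n ∸ ∣ S ∣)

IsProbability : ℝ → Set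
IsProbability p = 0ℝ ≤ p × p ≤ 1ℝ

-- p = p_c(F).  For nontrivial F there is exactly one such p up to ≃,
-- since μ F is strictly increasing on [0,1] from 0 to 1.
IsCriticalProbability : Family n → ℝ → Set
IsCriticalProbability F p = IsProbability p × μ F p ≃ ½ℝ

⟨_⟩ : Subset n → Subset n → Set
⟨ S ⟩ T = S ⊆ T

_Covers_ : Family n → Family n → Set
G Covers F = ∀ T → T ∈ᶠ F → ∃[ S ] (S ∈ᶠ G × ⟨ S ⟩ T)

_IsSmallFor_ : Family n → ℝ → Set
F IsSmallFor p =
  ∃[ G ] (G Covers F × ∑[ G ] (λ S → p ^ ∣ S ∣) ≤ ½ℝ)

-- q = q(F), the largest p ∈ [0,1] for which F is p-small.
IsExpectationThreshold : Family n → ℝ → Set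
IsExpectationThreshold F q =
  (IsProbability q × F IsSmallFor q) ×
  (∀ p → IsProbability p → F IsSmallFor p → p ≤ q)

IsMinimal : Family n → Subset n → Set
IsMinimal F A = A ∈ᶠ F × ¬ (∃[ B ] (B ∈ᶠ F × B ⊂ A))

isMinimal? : (F : Family n) (A : Subset n) → Dec (IsMinimal F A)
isMinimal? F A = (A ∈ᶠ? F) ×-dec ¬? (anySubset? λ B → (B ∈ᶠ? F) ×-dec (B ⊂? A))

minimals : Family n → List (Subset n)
minimals {n} F = filter (isMinimal? F) (subsets n)

ℓ₀ : Family n → ℕ
ℓ₀ F = max 0 (map ∣_∣ (minimals F))

ℓ : Family n → ℕ
ℓ F = ℓ₀ F ⊔ 2

log₂ℓ : Family n → ℝ
log₂ℓ F = log₂ (ℓ F) {{ℕ.>-nonZero (ℕ.<-≤-trans ℕ.z<s (ℕ.m≤n⊔m (ℓ₀ F) 2))}}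

TendsToInfinity : (ℕ → ℕ) → Set
TendsToInfinity a = ∀ M → ∃[ N ] (∀ n → N ℕ.≤ n → M ℕ.≤ a n)

-- q n stands for the expectation threshold of F n.
KahnKalaiNontrivial : ℝ → (size : ℕ → ℕ) → (∀ n → Family (size n)) → (ℕ → ℝ) → Set
KahnKalaiNontrivial K size F q =
  ∃[ N ] (∀ n → N ℕ.≤ n → K * q n * log₂ℓ (F n) < 1ℝ)

-- The index is an integer, so that there are no index sets I when k < 0
-- and the union is then empty.
σ : ∀ {m} → ℤ → (Fin m → Subset n) → Subset n
σ {m = m} k S =
  ⋃ (map (λ I → ⋂ (map S (filter (_∈? I) (allFin m))))
         (filter (λ I → + ∣ I ∣ ℤ.≟ k) (subsets m)))

-- If a point x lies in all but t of the minimal elements, then {x} together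
-- with the t remaining ones covers F, and none of these t + 1 sets is empty
-- since F is nontrivial.  Hence F is r-small for r = 1 / (2(t + 1)), and so
-- q(F) ≥ r.  As r does not depend on n, K q(F) log ℓ(F) would eventually be at
-- least 1, against the nontriviality of the Kahn-Kalai bounds.

module Submission where

open import Defs
import Data.Bool.Properties as Bool
open import Data.Fin.Base using (Fin; zero; suc)
import Data.Fin.Properties as Fin
open import Data.Fin.Subset
  using (Subset; inside; outside; Nonempty; _∈_; _⊆_; ∣_∣; ⋃; ⋂; ⁅_⁆; ∁; ⊥)
open import Data.Fin.Subset.Induction using (⊂-wellFounded)
open import Data.Fin.Subset.Properties
  using (_∈?_; _⊂?_; anySubset?; Empty-unique; nonempty?; ∉⊥; ⊥⊆; x∈⁅x⁆; x∈⁅y⁆⇒x≡y;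
         x∉p⇒x∈∁p; ∣∁p∣≡n∸∣p∣; x∈p⇒∣p-x∣<∣p∣; x∈p∩q⁻; x∈p∪q⁻)
open import Data.Integer.Base as ℤ using (+_)
import Data.Integer.Properties as ℤ
open import Data.List.Base using (List; []; _∷_; foldr; map; filter; allFin; length; lookup)
import Data.List.Membership.DecPropositional as DecMembership
open import Data.List.Membership.Propositional using () renaming (_∈_ to _∈ₗ_)
open import Data.List.Membership.Propositional.Properties
  using (∈-map⁺; ∈-map⁻; ∈-++⁺ˡ; ∈-++⁺ʳ; ∈-filter⁺; ∈-filter⁻; ∈-lookup; ∈-allFin)
open import Data.List.Membership.Setoid.Properties using (index-injective)
open import Data.List.Relation.Unary.All as All using (All; []; _∷_)
open import Data.List.Relation.Unary.Any using (here; there; index)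
open import Data.List.Relation.Unary.Any.Properties using (lookup-index)
open import Data.List.Relation.Unary.Unique.Propositional using (Unique; []; _∷_)
import Data.List.Relation.Unary.Unique.Propositional.Properties as Unique
open import Data.Nat.Base as ℕ using (ℕ; zero; suc; z≤n; s≤s; _⊔_)
open import Data.Nat.Logarithm using (⌊log₂_⌋; ⌊log₂⌋-mono-≤; ⌊log₂[2^n]⌋≡n)
import Data.Nat.Properties as ℕ
open import Data.Product.Base using (∃-syntax; _×_; _,_; proj₁; proj₂)
open import Data.Rational.Base as ℚ using (ℚ; 0ℚ; 1ℚ; ½)
import Data.Rational.Properties as ℚ
import Data.Rational.Solver as ℚ-Solver
import Data.Rational.Unnormalised.Base as ℚᵘ
import Data.Rational.Unnormalised.Properties as ℚᵘ
open import Data.Sum.Base using (inj₁; inj₂)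
open import Data.Vec.Base using ([]; _∷_; there)
import Data.Vec.Properties as Vec
open import Induction.WellFounded using (Acc; acc)
open import Relation.Binary.Definitions using (DecidableEquality)
open import Relation.Binary.PropositionalEquality
  using (_≡_; refl; sym; trans; cong; subst; subst₂; setoid)
open import Relation.Nullary.Decidable using (yes; no; ⌊_⌋; toWitness; fromWitness; _×-dec_)
open import Relation.Nullary.Negation using (¬_; contradiction)

private
  variable
    m n : ℕ
    A : Set

-- Finite lists and subsets

lookup-injective : {xs : List A} → Unique xs → ∀ i j → lookup xs i ≡ lookup xs j → i ≡ j
lookup-injective (_ ∷ _)    zero    zero    _  = refl
lookup-injective (x∉xs ∷ _) zero    (suc j) eq = contradiction eq (All.lookup x∉xs (∈-lookup j))
lookup-injective (x∉xs ∷ _) (suc i) zero    eq = contradiction (sym eq) (All.lookup x∉xs (∈-lookup i))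
lookup-injective (_ ∷ u)    (suc i) (suc j) eq = cong suc (lookup-injective u i j eq)

-- Each position of `xs` is sent to the position of the same element in `ys`. This map of finite
-- index sets is injective because `xs` has no repetitions.
unique-⊆⇒length≤ : {xs ys : List A} → Unique xs → (∀ {x} → x ∈ₗ xs → x ∈ₗ ys) →
                   length xs ℕ.≤ length ys
unique-⊆⇒length≤ {xs = xs} u sub = Fin.injective⇒≤ {f = λ i → index (sub (∈-lookup {xs = xs} i))}
  λ {i} {j} eq → lookup-injective u i j
    (index-injective (setoid _) (sub (∈-lookup i)) (sub (∈-lookup j)) eq)

∈-subsets : (S : Subset n) → S ∈ₗ subsets n
∈-subsets []            = here refl
∈-subsets (outside ∷ S) = ∈-++⁺ˡ (∈-map⁺ (outside ∷_) (∈-subsets S))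
∈-subsets (inside  ∷ S) = ∈-++⁺ʳ (map (outside ∷_) (subsets _)) (∈-map⁺ (inside ∷_) (∈-subsets S))

subsets-unique : ∀ n → Unique (subsets n)
subsets-unique zero    = [] ∷ []
subsets-unique (suc n) = Unique.++⁺
  (Unique.map⁺ Vec.∷-injectiveʳ (subsets-unique n))
  (Unique.map⁺ Vec.∷-injectiveʳ (subsets-unique n))
  λ (o , i) → heads-differ (proj₂ (proj₂ (∈-map⁻ (outside ∷_) o))) (proj₂ (proj₂ (∈-map⁻ (inside ∷_) i)))
  where
  heads-differ : ∀ {S : Subset (suc n)} {P Q} → S ≡ outside ∷ P → ¬ (S ≡ inside ∷ Q)
  heads-differ refl ()

_≟ₛ_ : DecidableEquality (Subset n)
_≟ₛ_ = Vec.≡-dec Bool._≟_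

-- Covers are Boolean-valued families, while the cover here arises as a list. Repeated entries of
-- the list count once in the family, so passing to `elements` can only shorten it.
fromList : List (Subset n) → Family n
fromList L S = ⌊ S ∈ₗ? L ⌋
  where open DecMembership _≟ₛ_ using () renaming (_∈?_ to _∈ₗ?_)

∈-fromList⁺ : ∀ {S : Subset n} (L : List (Subset n)) → S ∈ₗ L → S ∈ᶠ fromList L
∈-fromList⁺ L = fromWitness

∈-fromList⁻ : ∀ {S : Subset n} (L : List (Subset n)) → S ∈ᶠ fromList L → S ∈ₗ L
∈-fromList⁻ L = toWitness

elements-fromList⊆ : ∀ {S : Subset n} (L : List (Subset n)) → S ∈ₗ elements (fromList L) → S ∈ₗ L
elements-fromList⊆ {n} L S∈ = ∈-fromList⁻ L (proj₂ (∈-filter⁻ (_∈ᶠ? fromList L) {xs = subsets n} S∈))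

length-elements-fromList : (L : List (Subset n)) → length (elements (fromList L)) ℕ.≤ length L
length-elements-fromList {n} L =
  unique-⊆⇒length≤ (Unique.filter⁺ (_∈ᶠ? fromList L) (subsets-unique n)) (elements-fromList⊆ L)

-- Recursion along the bits of `I` ties the length of the result directly to `∣ I ∣`.
select : Subset m → (Fin m → A) → List A
select []            f = []
select (outside ∷ I) f = select I (λ i → f (suc i))
select (inside  ∷ I) f = f zero ∷ select I (λ i → f (suc i))

length-select : (I : Subset m) (f : Fin m → A) → length (select I f) ≡ ∣ I ∣
length-select []            f = refl
length-select (outside ∷ I) f = length-select I _
length-select (inside  ∷ I) f = cong suc (length-select I _)

∈-select⁺ : ∀ {i} (I : Subset m) (f : Fin m → A) → i ∈ I → f i ∈ₗ select I f
∈-select⁺ {i = zero}  (inside  ∷ I) f _                 = here refl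
∈-select⁺ {i = suc i} (inside  ∷ I) f (there i∈I) = there (∈-select⁺ I _ i∈I)
∈-select⁺ {i = suc i} (outside ∷ I) f (there i∈I) = ∈-select⁺ I _ i∈I

All-select : ∀ {P : A → Set} (I : Subset m) (f : Fin m → A) → (∀ i → P (f i)) → All P (select I f)
All-select []            f Pf = []
All-select (outside ∷ I) f Pf = All-select I _ (λ i → Pf (suc i))
All-select (inside  ∷ I) f Pf = Pf zero ∷ All-select I _ (λ i → Pf (suc i))

∈-⋃⁻ : ∀ {x : Fin n} Ss → x ∈ ⋃ Ss → ∃[ S ] (S ∈ₗ Ss × x ∈ S)
∈-⋃⁻ []       x∈ = contradiction x∈ ∉⊥
∈-⋃⁻ (S ∷ Ss) x∈ with x∈p∪q⁻ S (⋃ Ss) x∈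
... | inj₁ x∈S = S , here refl , x∈S
... | inj₂ x∈⋃ = let (S′ , S′∈ , x∈S′) = ∈-⋃⁻ Ss x∈⋃ in S′ , there S′∈ , x∈S′

∈-⋂⁻ : ∀ {x : Fin n} {S} Ss → x ∈ ⋂ Ss → S ∈ₗ Ss → x ∈ S
∈-⋂⁻ (S ∷ Ss) x∈ (here refl) = proj₁ (x∈p∩q⁻ S (⋂ Ss) x∈)
∈-⋂⁻ (S ∷ Ss) x∈ (there S∈)  = ∈-⋂⁻ Ss (proj₂ (x∈p∩q⁻ S (⋂ Ss) x∈)) S∈

∈-σ⁻ : ∀ {x : Fin n} k (S : Fin m → Subset n) → x ∈ σ k S →
       ∃[ I ] (+ ∣ I ∣ ≡ k × (∀ i → i ∈ I → x ∈ S i))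
∈-σ⁻ {m = m} k S x∈σ =
  let (_ , U∈ , x∈U)  = ∈-⋃⁻ _ x∈σ
      (I , I∈ , U≡)   = ∈-map⁻ (λ I → ⋂ (map S (filter (_∈? I) (allFin m)))) U∈
      (_ , ∣I∣≡k)     = ∈-filter⁻ (λ I → + ∣ I ∣ ℤ.≟ k) {xs = subsets m} I∈
  in I , ∣I∣≡k , λ i i∈I →
       ∈-⋂⁻ _ (subst (_ ∈_) U≡ x∈U) (∈-map⁺ S (∈-filter⁺ (_∈? I) (∈-allFin i) i∈I))

-- Over the integers the equation can be rearranged to `∣ I ∣ + t ≡ m`, after which truncated
-- subtraction loses nothing. If `t` exceeds `m`, no `I` satisfies the hypothesis.
∣∁I∣≤t : ∀ t (I : Subset m) → + ∣ I ∣ ≡ + m ℤ.- + t → ∣ ∁ I ∣ ℕ.≤ t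
∣∁I∣≤t {m} t I eq = ℕ.≤-reflexive (trans (∣∁p∣≡n∸∣p∣ I)
  (trans (cong (ℕ._∸ ∣ I ∣) (sym ∣I∣+t≡m)) (ℕ.m+n∸m≡n ∣ I ∣ t)))
  where
  ∣I∣+t≡m : ∣ I ∣ ℕ.+ t ≡ m
  ∣I∣+t≡m = ℤ.+-injective (trans (cong (ℤ._+ (+ t)) eq)
    (trans (ℤ.+-assoc (+ m) (ℤ.- + t) (+ t))
    (trans (cong (ℤ._+_ (+ m)) (ℤ.+-inverseˡ (+ t))) (ℤ.+-identityʳ (+ m)))))

nonempty⇒0<∣p∣ : {S : Subset n} → Nonempty S → 0 ℕ.< ∣ S ∣
nonempty⇒0<∣p∣ (x , x∈S) = ℕ.≤-<-trans z≤n (x∈p⇒∣p-x∣<∣p∣ x∈S)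

-- Upper sets and their minimal elements

module _ (F : Family n) where

  -- Descend to a strictly smaller member as long as one exists; this stops because strict inclusion
  -- is well-founded.
  minimal-below : ∀ {S} → S ∈ᶠ F → ∃[ M ] (M ∈ₗ minimals F × M ⊆ S)
  minimal-below {S} = go S (⊂-wellFounded S)
    where
    go : ∀ S → Acc _ S → S ∈ᶠ F → ∃[ M ] (M ∈ₗ minimals F × M ⊆ S)
    go S (acc rec) S∈F with anySubset? (λ B → (B ∈ᶠ? F) ×-dec (B ⊂? S))
    ... | yes (B , B∈F , B⊂S) =
      let (M , M∈ , M⊆B) = go B (rec B⊂S) B∈F in M , M∈ , λ x∈M → proj₁ B⊂S (M⊆B x∈M)
    ... | no ∄B = S , ∈-filter⁺ (isMinimal? F) (∈-subsets S) (S∈F , ∄B) , λ x∈S → x∈S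

  minimals⊆ : ∀ {S} → S ∈ₗ minimals F → S ∈ᶠ F
  minimals⊆ S∈ = proj₁ (proj₂ (∈-filter⁻ (isMinimal? F) {xs = subsets n} S∈))

  -- If `⊥` were a member, upward closure would make every subset a member.
  members-nonempty : IsUpperSet F → IsNontrivial F → ∀ {S} → S ∈ᶠ F → Nonempty S
  members-nonempty up (_ , not-full) {S} S∈F with nonempty? S
  ... | yes ne = ne
  ... | no ¬ne = contradiction
    (λ B → up (subst (_∈ᶠ F) (Empty-unique ¬ne) S∈F) ⊥⊆) not-full

  module _ (x : Fin n) (I : Subset (length (minimals F))) where

    coverList : List (Subset n)
    coverList = ⁅ x ⁆ ∷ select (∁ I) (lookup (minimals F))

    -- Take a minimal `M` below `S`. If its index is in `I`, then `x` lies in `M`, so `⁅ x ⁆` is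
    -- below `S`; otherwise `M` itself is in the list.
    coverList-covers : (∀ i → i ∈ I → x ∈ lookup (minimals F) i) → fromList coverList Covers F
    coverList-covers x∈ S S∈F with minimal-below S∈F
    ... | M , M∈ , M⊆S with index M∈ ∈? I
    ...   | yes i∈I = ⁅ x ⁆ , ∈-fromList⁺ coverList (here refl) , λ y∈ →
      subst (_∈ S) (sym (x∈⁅y⁆⇒x≡y x y∈))
        (M⊆S (subst (x ∈_) (sym (lookup-index M∈)) (x∈ (index M∈) i∈I)))
    ...   | no i∉I = M , ∈-fromList⁺ coverList (there (subst (_∈ₗ select (∁ I) (lookup (minimals F)))
        (sym (lookup-index M∈)) (∈-select⁺ (∁ I) _ (x∉p⇒x∈∁p i∉I)))) , M⊆S

    coverList-sizes : IsUpperSet F → IsNontrivial F → All (λ S → 0 ℕ.< ∣ S ∣) coverList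
    coverList-sizes up nt = nonempty⇒0<∣p∣ (x , x∈⁅x⁆ x) ∷
      All-select (∁ I) _ λ i →
        nonempty⇒0<∣p∣ (members-nonempty up nt (minimals⊆ (∈-lookup {xs = minimals F} i)))

-- Inequalities between reals

-- A witness of `y < x` is already refuted at its own index `N`.
pointwise⇒≤ : ∀ x y → (∀ n → seq x n ℚ.≤ seq y n) → x ≤ y
pointwise⇒≤ x y x≤y (ε , 0<ε , N , h) = ℚ.<-irrefl refl (begin-strict
  seq y N          ≡⟨ ℚ.+-identityʳ (seq y N) ⟨
  seq y N ℚ.+ 0ℚ   <⟨ ℚ.+-monoʳ-< (seq y N) 0<ε ⟩
  seq y N ℚ.+ ε    <⟨ h N ℕ.≤-refl ⟩
  seq x N          ≤⟨ x≤y N ⟩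
  seq y N          ∎)
  where open ℚ.≤-Reasoning

p≤∣p∣ : ∀ p → p ℚ.≤ ℚ.∣ p ∣
p≤∣p∣ p with ℚ.≤-total 0ℚ p
... | inj₁ 0≤p = ℚ.≤-reflexive (sym (ℚ.0≤p⇒∣p∣≡p 0≤p))
... | inj₂ p≤0 = ℚ.≤-trans p≤0 (ℚ.0≤∣p∣ p)

∣p-q∣<r⇒p<q+r : ∀ p q {r} → ℚ.∣ p ℚ.- q ∣ ℚ.< r → p ℚ.< q ℚ.+ r
∣p-q∣<r⇒p<q+r p q {r} close = begin-strict
  p                      ≡⟨ split p q ⟩
  q ℚ.+ (p ℚ.- q)        ≤⟨ ℚ.+-monoʳ-≤ q (p≤∣p∣ (p ℚ.- q)) ⟩
  q ℚ.+ ℚ.∣ p ℚ.- q ∣    <⟨ ℚ.+-monoʳ-< q close ⟩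
  q ℚ.+ r                ∎
  where
  open ℚ.≤-Reasoning
  open ℚ-Solver.+-*-Solver
  split : ∀ a b → a ≡ b ℚ.+ (a ℚ.- b)
  split = solve 2 (λ a b → a := b :+ (a :- b)) refl

-- x ≤ y is a negation, so a rational lower bound for the terms of x is found
-- by deciding where one far term lies; the slack a - b = η + η + δ
-- absorbs the oscillation of the later terms.
fromℚ≤⇒eventually-> : ∀ a b x → b ℚ.< a → fromℚ a ≤ x → ∃[ N ] (∀ n → N ℕ.≤ n → b ℚ.< seq x n)
fromℚ≤⇒eventually-> a b x b<a a≤x = N , bound
  where
  δ = ½ ℚ.* (a ℚ.- b)
  η = ½ ℚ.* δ
  0<a-b : 0ℚ ℚ.< a ℚ.- b
  0<a-b = subst (ℚ._< a ℚ.- b) (ℚ.+-inverseʳ b) (ℚ.+-monoˡ-< (ℚ.- b) b<a)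
  0<δ = half (a ℚ.- b) 0<a-b
  N = proj₁ (cauchy x η (half δ 0<δ))
  near = proj₂ (cauchy x η (half δ 0<δ))
  open ℚ.≤-Reasoning
  open ℚ-Solver.+-*-Solver
  collect : ((b ℚ.+ η) ℚ.+ η) ℚ.+ δ ≡ a
  collect = trans (trans (cong (ℚ._+ δ) (trans (ℚ.+-assoc b η η) (cong (b ℚ.+_) (half+half δ))))
                  (trans (ℚ.+-assoc b δ δ) (cong (b ℚ.+_) (half+half (a ℚ.- b)))))
            (solve 2 (λ a b → b :+ (a :- b) := a) refl a b)
  bound : ∀ n → N ℕ.≤ n → b ℚ.< seq x n
  bound n n≥ with seq x N ℚ.≤? b ℚ.+ η
  ... | yes low = contradiction (δ , 0<δ , N , λ k k≥ → begin-strict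
    seq x k ℚ.+ δ            <⟨ ℚ.+-monoˡ-< δ (∣p-q∣<r⇒p<q+r (seq x k) (seq x N) (near k N k≥ ℕ.≤-refl)) ⟩
    (seq x N ℚ.+ η) ℚ.+ δ    ≤⟨ ℚ.+-monoˡ-≤ δ (ℚ.+-monoˡ-≤ η low) ⟩
    ((b ℚ.+ η) ℚ.+ η) ℚ.+ δ  ≡⟨ collect ⟩
    a                        ∎) a≤x
  ... | no high = ℚ.≰⇒> λ xn≤b → ℚ.<-irrefl refl (begin-strict
    seq x N        <⟨ ∣p-q∣<r⇒p<q+r (seq x N) (seq x n) (near N n ℕ.≤-refl n≥) ⟩
    seq x n ℚ.+ η  ≤⟨ ℚ.+-monoˡ-≤ η xn≤b ⟩
    b ℚ.+ η        <⟨ ℚ.≰⇒> high ⟩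
    seq x N        ∎)

-- Powers of 1/(d + 1) and short covers

module _ (d : ℕ) where

  private
    r = + 1 ℚ./ suc d

  0≤1/d : 0ℚ ℚ.≤ r
  0≤1/d = /-mono 0 1 0 d z≤n

  1/d≤1 : r ℚ.≤ 1ℚ
  1/d≤1 = /-mono 1 1 d 0 (s≤s z≤n)

  0<1/d : 0ℚ ℚ.< r
  0<1/d = ℚ.positive⁻¹ r {{ℚ.normalize-pos 1 (suc d)}}

  1/d-isProbability : IsProbability (fromℚ r)
  1/d-isProbability = pointwise⇒≤ 0ℝ (fromℚ r) (λ _ → 0≤1/d) , pointwise⇒≤ (fromℚ r) 1ℝ (λ _ → 1/d≤1)

  -- The two bounds are proved by mutual recursion. The bound by `r` needs a positive exponent,
  -- since the zeroth power is 1; this is why the sets of the cover must be nonempty.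
  1/d^1+k≤1/d : ∀ k i → seq (fromℚ r ^ suc k) i ℚ.≤ r
  1/d^k≤1 : ∀ k i → seq (fromℚ r ^ k) i ℚ.≤ 1ℚ

  1/d^1+k≤1/d k i = subst (seq (fromℚ r ^ suc k) i ℚ.≤_) (ℚ.*-identityʳ r)
    (ℚ.*-monoˡ-≤-nonNeg r {{ℚ.nonNegative 0≤1/d}} (1/d^k≤1 k i))

  1/d^k≤1 zero    i = ℚ.≤-refl
  1/d^k≤1 (suc k) i = ℚ.≤-trans (1/d^1+k≤1/d k i) 1/d≤1

  0<k⇒1/d^k≤1/d : ∀ {k} → 0 ℕ.< k → ∀ i → seq (fromℚ r ^ k) i ℚ.≤ r
  0<k⇒1/d^k≤1/d {suc k} _ = 1/d^1+k≤1/d k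

  foldr≤length/d : (f : Subset n → ℝ) (Ss : List (Subset n)) →
    ∀ i → (∀ {S} → S ∈ₗ Ss → seq (f S) i ℚ.≤ r) →
    seq (foldr (λ S s → f S + s) 0ℝ Ss) i ℚ.≤ + length Ss ℚ./ suc d
  foldr≤length/d f []       i f≤ = /-mono 0 0 0 d z≤n
  foldr≤length/d f (S ∷ Ss) i f≤ =
    subst (seq (f S) i ℚ.+ seq (foldr (λ S s → f S + s) 0ℝ Ss) i ℚ.≤_) (sym (/-suc (length Ss) d))
      (ℚ.+-mono-≤ (f≤ (here refl)) (foldr≤length/d f Ss i (λ S∈ → f≤ (there S∈))))

  -- The sum has at most `length L` terms, each at most 1/(d + 1) at every index, and `length L` is
  -- at most (d + 1)/2.
  ∑≤½ : (L : List (Subset n)) (f : Subset n → ℝ) → (∀ {S} → S ∈ₗ L → ∀ i → seq (f S) i ℚ.≤ r) →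
    length L ℕ.* 2 ℕ.≤ suc d → ∑[ fromList L ] f ≤ ½ℝ
  ∑≤½ L f f≤ len = pointwise⇒≤ (∑[ fromList L ] f) ½ℝ λ i → ℚ.≤-trans
    (foldr≤length/d f (elements (fromList L)) i (λ S∈ → f≤ (elements-fromList⊆ L S∈) i))
    (/-mono (length (elements (fromList L))) 1 d 1 (begin
      length (elements (fromList L)) ℕ.* 2 ≤⟨ ℕ.*-monoˡ-≤ 2 (length-elements-fromList L) ⟩
      length L ℕ.* 2                       ≤⟨ len ⟩
      suc d                                ≡⟨ ℕ.*-identityˡ (suc d) ⟨
      1 ℕ.* suc d                          ∎))
    where open ℕ.≤-Reasoning

short-cover⇒small : ∀ d (F : Family n) (L : List (Subset n)) → fromList L Covers F →
  All (λ S → 0 ℕ.< ∣ S ∣) L → length L ℕ.* 2 ℕ.≤ suc d → F IsSmallFor fromℚ (+ 1 ℚ./ suc d)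
short-cover⇒small d F L covers sizes len = fromList L , covers ,
  ∑≤½ d L (λ S → fromℚ (+ 1 ℚ./ suc d) ^ ∣ S ∣)
    (λ {S} S∈ → 0<k⇒1/d^k≤1/d d {∣ S ∣} (All.lookup sizes S∈)) len

-- Lower bounds for the logarithm and for the product

-- Raising the hypothesis to the power i + 1 shows that the floor in the approximation is at least
-- L(i + 1). The bound thus holds at every index, with no error term.
2^L≤m⇒L≤log-approx : ∀ L m i → 2 ℕ.^ L ℕ.≤ m → + L ℚ./ 1 ℚ.≤ log-approx m i
2^L≤m⇒L≤log-approx L m i 2^L≤m = /-mono L ⌊log₂ m ℕ.^ suc i ⌋ 0 i (begin
  L ℕ.* suc i                     ≡⟨ ⌊log₂[2^n]⌋≡n (L ℕ.* suc i) ⟨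
  ⌊log₂ 2 ℕ.^ (L ℕ.* suc i) ⌋     ≡⟨ cong ⌊log₂_⌋ (ℕ.^-*-assoc 2 L (suc i)) ⟨
  ⌊log₂ (2 ℕ.^ L) ℕ.^ suc i ⌋     ≤⟨ ⌊log₂⌋-mono-≤ (ℕ.^-monoˡ-≤ (suc i) 2^L≤m) ⟩
  ⌊log₂ m ℕ.^ suc i ⌋             ≡⟨ ℕ.*-identityʳ _ ⟨
  ⌊log₂ m ℕ.^ suc i ⌋ ℕ.* 1       ∎)
  where open ℕ.≤-Reasoning

1/d*d≡1 : ∀ d → + 1 ℚ./ suc d ℚ.* (+ suc d ℚ./ 1) ≡ 1ℚ
1/d*d≡1 d = ℚ.toℚᵘ-injective (begin
  ℚ.toℚᵘ (+ 1 ℚ./ suc d ℚ.* (+ suc d ℚ./ 1))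
    ≈⟨ ℚ.toℚᵘ-homo-* (+ 1 ℚ./ suc d) (+ suc d ℚ./ 1) ⟩
  ℚ.toℚᵘ (+ 1 ℚ./ suc d) ℚᵘ.* ℚ.toℚᵘ (+ suc d ℚ./ 1)
    ≈⟨ ℚᵘ.*-cong (ℚ.toℚᵘ-fromℚᵘ (ℚᵘ.mkℚᵘ (+ 1) d)) (ℚ.toℚᵘ-fromℚᵘ (ℚᵘ.mkℚᵘ (+ suc d) 0)) ⟩
  ℚᵘ.mkℚᵘ (+ 1) d ℚᵘ.* ℚᵘ.mkℚᵘ (+ suc d) 0
    ≈⟨ ℚᵘ.*≡* (trans (ℤ.*-identityʳ _) (cong (ℤ._*_ (+ 1)) (sym (ℤ.*-identityʳ (+ suc d))))) ⟩
  ℚ.toℚᵘ 1ℚ ∎)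
  where open ℚᵘ.≃-Reasoning

archimedean-* : ∀ c → 0ℚ ℚ.< c → ∃[ L ] (1ℚ ℚ.≤ c ℚ.* (+ L ℚ./ 1))
archimedean-* c 0<c =
  let (d , 1/d<c) = archimedean c 0<c
  in suc d , subst (ℚ._≤ c ℚ.* (+ suc d ℚ./ 1)) (1/d*d≡1 d)
       (ℚ.*-monoʳ-≤-nonNeg (+ suc d ℚ./ 1) {{ℚ.normalize-nonNeg (suc d) 1}} (ℚ.<⇒≤ 1/d<c))

*-mono-≤-nonNeg : ∀ {a b c d} → 0ℚ ℚ.≤ a → 0ℚ ℚ.≤ d → a ℚ.≤ b → c ℚ.≤ d → a ℚ.* c ℚ.≤ b ℚ.* d
*-mono-≤-nonNeg {a} {b} {c} {d} 0≤a 0≤d a≤b c≤d = ℚ.≤-trans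
  (ℚ.*-monoˡ-≤-nonNeg a {{ℚ.nonNegative 0≤a}} c≤d)
  (ℚ.*-monoʳ-≤-nonNeg d {{ℚ.nonNegative 0≤d}} a≤b)

*-pos : ∀ {a b} → 0ℚ ℚ.< a → 0ℚ ℚ.< b → 0ℚ ℚ.< a ℚ.* b
*-pos {a} {b} 0<a 0<b = ℚ.positive⁻¹ (a ℚ.* b) {{ℚ.pos*pos⇒pos a {{ℚ.positive 0<a}} b {{ℚ.positive 0<b}}}}

½*p<p : ∀ {p} → 0ℚ ℚ.< p → ½ ℚ.* p ℚ.< p
½*p<p {p} 0<p = subst₂ ℚ._<_ (ℚ.+-identityʳ (½ ℚ.* p)) (half+half p)
  (ℚ.+-monoʳ-< (½ ℚ.* p) (half p 0<p))

-- Strict inequality of reals gives information about all late terms, so a single late term suffices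
-- for the contradiction. There the three factors are at least `κ`, `b` and `L`, whose product is at
-- least 1.
product≮1 : ∀ K q (F : Family n) κ b L → 0ℚ ℚ.< κ → 0ℚ ℚ.< b →
  1ℚ ℚ.≤ κ ℚ.* b ℚ.* (+ L ℚ./ 1) →
  ∃[ M ] (∀ i → M ℕ.≤ i → κ ℚ.< seq K i) → ∃[ N ] (∀ i → N ℕ.≤ i → b ℚ.< seq q i) →
  2 ℕ.^ L ℕ.≤ ℓ F → ¬ (K * q * log₂ℓ F < 1ℝ)
product≮1 K q F κ b L 0<κ 0<b 1≤κbL (N₁ , κ<K) (N₂ , b<q) 2^L≤ℓ (ε , 0<ε , N₃ , Kql<1) =
  ℚ.<-irrefl {1ℚ} refl (begin-strict
    1ℚ                       ≤⟨ 1≤κbL ⟩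
    κ ℚ.* b ℚ.* (+ L ℚ./ 1)  ≤⟨ *-mono-≤-nonNeg {κ ℚ.* b} {k ℚ.* l} {+ L ℚ./ 1} {log}
                                  (ℚ.<⇒≤ (*-pos 0<κ 0<b)) (ℚ.≤-trans (/-mono 0 L 0 0 z≤n) L≤log)
                                  (*-mono-≤-nonNeg {κ} {k} {b} {l} (ℚ.<⇒≤ 0<κ)
                                    (ℚ.≤-trans (ℚ.<⇒≤ 0<b) b≤l) κ≤k b≤l)
                                  L≤log ⟩
    k ℚ.* l ℚ.* log          ≡⟨ ℚ.+-identityʳ (k ℚ.* l ℚ.* log) ⟨
    k ℚ.* l ℚ.* log ℚ.+ 0ℚ   <⟨ ℚ.+-monoʳ-< (k ℚ.* l ℚ.* log) 0<ε ⟩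
    k ℚ.* l ℚ.* log ℚ.+ ε    <⟨ Kql<1 i (ℕ.m≤n⊔m (N₁ ⊔ N₂) N₃) ⟩
    1ℚ                       ∎)
  where
  open ℚ.≤-Reasoning
  -- An index late enough for the bounds on `K`, on `q` and on the product.
  i = N₁ ⊔ N₂ ⊔ N₃
  k = seq K i
  l = seq q i
  log = log-approx (ℓ F) i
  κ≤k = ℚ.<⇒≤ (κ<K i (ℕ.≤-trans (ℕ.m≤m⊔n N₁ N₂) (ℕ.m≤m⊔n (N₁ ⊔ N₂) N₃)))
  b≤l = ℚ.<⇒≤ (b<q i (ℕ.≤-trans (ℕ.m≤n⊔m N₁ N₂) (ℕ.m≤m⊔n (N₁ ⊔ N₂) N₃)))
  L≤log = 2^L≤m⇒L≤log-approx L (ℓ F) i 2^L≤ℓ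

-- The exponent `L` is chosen from `r` and `K` alone, before `q` and `F`, so one `L` serves the
-- whole sequence of families.
threshold≥r⇒product≮1 : ∀ r → 0ℚ ℚ.< r → ∀ K → 0ℝ < K →
  ∃[ L ] (∀ {n} q (F : Family n) → fromℚ r ≤ q → 2 ℕ.^ L ℕ.≤ ℓ F → ¬ (K * q * log₂ℓ F < 1ℝ))
threshold≥r⇒product≮1 r 0<r K (κ , 0<κ , N , κ<K) =
  let (L , 1≤κbL) = archimedean-* (κ ℚ.* b) (*-pos 0<κ 0<b)
  in L , λ q F r≤q → product≮1 K q F κ b L 0<κ 0<b 1≤κbL
       (N , λ i i≥ → subst (ℚ._< seq K i) (ℚ.+-identityˡ κ) (κ<K i i≥))
       (fromℚ≤⇒eventually-> r b q (½*p<p 0<r) r≤q)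
  where
  -- The terms of `q` may stay slightly below `r` even if `r` is a lower bound for the real `q`;
  -- eventually they exceed any smaller rational, such as `½ * r`.
  b = ½ ℚ.* r
  0<b = half r 0<r

-- The threshold bound and the conclusion

-- The denominator is 2(t + 1), twice the largest possible length of `coverList`. Hence `F` is small
-- for this fraction, and maximality of `q` applies.
expectationThreshold-≥ : ∀ t (F : Family n) q {x} → IsUpperSet F → IsNontrivial F →
  IsExpectationThreshold F q →
  x ∈ σ (+ length (minimals F) ℤ.- + t) (lookup (minimals F)) →
  fromℚ (+ 1 ℚ./ suc (suc (t ℕ.* 2))) ≤ q
expectationThreshold-≥ t F q {x} up nt (_ , largest) x∈σ =
  let (I , ∣I∣≡ , x∈) = ∈-σ⁻ _ (lookup (minimals F)) x∈σ
  in largest (fromℚ (+ 1 ℚ./ suc (suc (t ℕ.* 2)))) (1/d-isProbability (suc (t ℕ.* 2)))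
       (short-cover⇒small (suc (t ℕ.* 2)) F (coverList F x I) (coverList-covers F x I x∈)
         (coverList-sizes F x I up nt)
         -- The complement of `I` contributes at most `t` sets and `⁅ x ⁆` one more; `suc t * 2`
         -- computes to `suc (suc (t * 2))`.
         (ℕ.*-monoˡ-≤ 2 (s≤s (subst (ℕ._≤ t) (sym (length-select (∁ I) (lookup (minimals F)))) (∣∁I∣≤t t I ∣I∣≡)))))

corollary5p9 : (size : ℕ → ℕ) (F : ∀ n → Family (size n)) →
    (∀ n → IsUpperSet (F n)) →
    (∀ n → IsNontrivial (F n)) →
    (pc q : ℕ → ℝ) →
    (∀ n → IsCriticalProbability (F n) (pc n)) →
    (∀ n → IsExpectationThreshold (F n) (q n)) →
    (K : ℝ) → 0ℝ < K →
    (∀ n → pc n ≤ K * q n * log₂ℓ (F n)) →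
    TendsToInfinity (λ n → ℓ (F n)) →
    KahnKalaiNontrivial K size F q →
    (t : ℕ) →
    ∃[ N ] (∀ n → N ℕ.≤ n →
    σ (+ length (minimals (F n)) ℤ.- + t) (lookup (minimals (F n))) ≡ ⊥)
corollary5p9 size F up nt pc q _ threshold K 0<K _ ℓ→∞ (N₂ , Kqlog<1) t =
  -- `t` fixes the fraction, which together with `K` fixes `L`; only then is the growth of `ℓ` used,
  -- to get past `2 ^ L`.
  let (L , Kqlog≮1) = threshold≥r⇒product≮1 (+ 1 ℚ./ suc (suc (t ℕ.* 2))) (0<1/d (suc (t ℕ.* 2))) K 0<K
      (N₁ , 2^L≤ℓ)  = ℓ→∞ (2 ℕ.^ L)
  in N₁ ⊔ N₂ , λ n n≥ → Empty-unique λ (x , x∈σ) →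
       Kqlog≮1 (q n) (F n)
         (expectationThreshold-≥ t (F n) (q n) (up n) (nt n) (threshold n) x∈σ)
         (2^L≤ℓ n (ℕ.m⊔n≤o⇒m≤o N₁ N₂ n≥))
         (Kqlog<1 n (ℕ.m⊔n≤o⇒n≤o N₁ N₂ n≥))
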